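{- For all integers $n,k\ge 0$, we have $|S_{n,k}|\le (C_n)^k$, where $C_n=\frac{1}{n+1}\binom{2n}{n}$.
   Context: $S_n$ is the set of permutations of $\{0,1,\ldots,n-1\}$, written as sequences of length $n$. $I_n$ is the set of inversion sequences of length $n$, i.e. integer sequences $\sigma=(\sigma_1,\ldots,\sigma_n)$ with $0\le\sigma_i<i$ for every $1\le i\le n$ (the empty sequence is allowed, with $n=0$). For a finite integer sequence $\sigma$ of length $n$, $\Theta(\sigma)$ is the sequence of length $n$ defined by $\Theta(\sigma)_i=\#\{j<i:\sigma_j<\sigma_i\}$; $\Theta^k$ is the $k$-fold iterate, with $\Theta^0$ the identity. $FP_n=\{\sigma\in I_n:\Theta(\sigma)=\sigma\}$ and $S_{n,k}=\{\sigma\in S_n:\Theta^k(\sigma)\in FP_n\}$. -}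

module Defs where

open import Data.Fin.Base using (Fin; toℕ)
import Data.Fin.Base as Fin
import Data.Fin.Properties as Fin
open import Data.List.Base using (List; []; _∷_; _++_; [_]; length; filter; allFin; upTo; cartesianProductWith)
open import Data.List.Membership.Propositional using (_∈_)
open import Data.List.Membership.Propositional.Properties using (∈-∃++; ∈-filter⁺; ∈-filter⁻; ∈-cartesianProductWith⁺)
import Data.List.Membership.DecPropositional as DecMembership
open import Data.List.Relation.Unary.All using ([])
open import Data.List.Relation.Unary.AllPairs using ([]; _∷_)
open import Data.List.Relation.Unary.Any using (here; there)
open import Data.List.Relation.Unary.Unique.Propositional using (Unique)
import Data.List.Relation.Unary.Unique.Propositional.Properties as Unique
open import Data.List.Relation.Binary.Permutation.Propositional using (_↭_; ↭-refl; ↭-sym; ↭-trans; prep)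
open import Data.List.Relation.Binary.Permutation.Propositional.Properties using (∈-resp-↭; drop-∷; shift; ¬x∷xs↭[])
open import Data.Nat.Base using (ℕ; zero; suc; _+_; _*_; _<_)
open import Data.Nat.Combinatorics using (_C_; nCk+nC[k+1]≡[n+1]C[k+1]; nC1≡n)
open import Data.Nat.Divisibility using (_∣_; divides; ∣m+n∣m⇒∣n; m∣m*n)
open import Data.Nat.DivMod using (_/_; m/n*n≡m)
open import Data.Nat.Properties using (_≟_; _<?_; *-comm; *-distribˡ-+; *-zeroʳ)
open import Data.Nat.Tactic.RingSolver using (solve-∀)
open import Data.Nat.GeneralisedArithmetic using (fold)
open import Data.Product.Base using (_×_; _,_; proj₁; proj₂)
open import Data.Vec.Base using (Vec; []; _∷_; lookup; tabulate; toList)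
open import Data.Vec.Properties using (≡-dec; ∷-injective)
open import Function.Base using (_∘_)
open import Function.Bundles using (_⇔_; mk⇔)
open import Level using (0ℓ)
open import Relation.Binary.PropositionalEquality using (_≡_; refl; sym; trans; cong; cong₂; subst; module ≡-Reasoning)
open import Relation.Nullary using (Dec; yes; no)
open import Relation.Nullary.Decidable using (_×-dec_)
import Relation.Nullary.Decidable as Dec
open import Relation.Unary using (Pred; Decidable)

-- A sequence (σ₁,…,σₙ) is a vector, so positions are counted from 0: the
-- entry σᵢ is  lookup σ (i - 1).  Entries are natural numbers, since the members of
-- Iₙ and Sₙ and all values of Θ are sequences of non-negative integers.

Perm : ∀ n → Pred (Vec ℕ n) 0ℓ
Perm n σ = toList σ ↭ upTo n

-- 0 ≤ σᵢ < i for 1 ≤ i ≤ n, with i = suc (toℕ j).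
InvSeq : ∀ n → Pred (Vec ℕ n) 0ℓ
InvSeq n σ = ∀ (j : Fin n) → lookup σ j < suc (toℕ j)

Θ : ∀ {n} → Vec ℕ n → Vec ℕ n
Θ {n} σ = tabulate λ i →
  length (filter (λ j → (j Fin.<? i) ×-dec (lookup σ j <? lookup σ i)) (allFin n))

Θ^ : ∀ {n} → ℕ → Vec ℕ n → Vec ℕ n
Θ^ k σ = fold σ Θ k

FP : ∀ n → Pred (Vec ℕ n) 0ℓ
FP n σ = InvSeq n σ × Θ σ ≡ σ

S : ∀ n k → Pred (Vec ℕ n) 0ℓ
S n k σ = Perm n σ × FP n (Θ^ k σ)

-- The set {x | P x} is finite, witnessed by a list without repetitions of
-- exactly its members; the length of such a list does not depend on the choice.
record Finite {A : Set} (P : Pred A 0ℓ) : Set where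
  field
    members  : List A
    distinct : Unique members
    complete : ∀ x → x ∈ members ⇔ P x

card : ∀ {A : Set} {P : Pred A 0ℓ} → Finite P → ℕ
card F = length (Finite.members F)

_↭?_ : (xs ys : List ℕ) → Dec (xs ↭ ys)
[]       ↭? []       = yes ↭-refl
[]       ↭? (y ∷ ys) = no (¬x∷xs↭[] ∘ ↭-sym)
(x ∷ xs) ↭? ys with DecMembership._∈?_ _≟_ x ys
... | no x∉ys = no λ p → x∉ys (∈-resp-↭ p (here refl))
... | yes x∈ys with ∈-∃++ x∈ys
...   | as , bs , refl =
  Dec.map′ (λ p → ↭-trans (prep x p) (↭-sym (shift x as bs)))
           (λ p → drop-∷ (↭-trans p (shift x as bs)))
           (xs ↭? (as ++ bs))

S? : ∀ n k → Decidable (S n k)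
S? n k σ = (toList σ ↭? upTo n)
  ×-dec (Fin.all? (λ j → lookup (Θ^ k σ) j <? suc (toℕ j))
  ×-dec ≡-dec _≟_ (Θ (Θ^ k σ)) (Θ^ k σ))

vecs : ∀ {A : Set} → List A → ∀ n → List (Vec A n)
vecs xs zero    = [ [] ]
vecs xs (suc n) = cartesianProductWith _∷_ xs (vecs xs n)

vecs-unique : ∀ {A : Set} {xs : List A} → Unique xs → ∀ n → Unique (vecs xs n)
vecs-unique u zero    = [] ∷ []
vecs-unique u (suc n) = Unique.cartesianProductWith⁺ _∷_ ∷-injective u (vecs-unique u n)

∈-vecs : ∀ {A : Set} {xs : List A} {n} (v : Vec A n) →
         (∀ {x} → x ∈ toList v → x ∈ xs) → v ∈ vecs xs n
∈-vecs []      f = here refl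
∈-vecs (x ∷ v) f = ∈-cartesianProductWith⁺ _∷_ (f (here refl)) (∈-vecs v (f ∘ there))

S-finite : ∀ n k → Finite (S n k)
S-finite n k = record
  { members  = filter (S? n k) (vecs (upTo n) n)
  ; distinct = Unique.filter⁺ (S? n k) (vecs-unique (Unique.upTo⁺ n) n)
  ; complete = λ σ → mk⇔
      (λ σ∈ → proj₂ (∈-filter⁻ (S? n k) {xs = vecs (upTo n) n} σ∈))
      (λ s → ∈-filter⁺ (S? n k) (∈-vecs σ (∈-resp-↭ (proj₁ s))) s)
  }

-- The division is exact, see [n+1]*catalan≡2nCn.
catalan : ℕ → ℕ
catalan n = ((2 * n) C n) / suc n

[k+1]*[m+1]C[k+1]≡[m+1]*mCk : ∀ m k → suc k * (suc m C suc k) ≡ suc m * (m C k)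
[k+1]*[m+1]C[k+1]≡[m+1]*mCk zero    zero    = refl
[k+1]*[m+1]C[k+1]≡[m+1]*mCk zero    (suc k) = *-zeroʳ (suc (suc k))
[k+1]*[m+1]C[k+1]≡[m+1]*mCk (suc m) zero    = begin
  1 * (suc (suc m) C 1)  ≡⟨ cong (1 *_) (nC1≡n (suc (suc m))) ⟩
  1 * suc (suc m)        ≡⟨ *-comm 1 (suc (suc m)) ⟩
  suc (suc m) * 1        ∎
  where open ≡-Reasoning
[k+1]*[m+1]C[k+1]≡[m+1]*mCk (suc m) (suc k) = begin
  (2 + k) * (suc (suc m) C (2 + k))
    ≡⟨ cong ((2 + k) *_) (nCk+nC[k+1]≡[n+1]C[k+1] (suc m) (suc k)) ⟨
  (2 + k) * (c + (suc m C (2 + k)))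
    ≡⟨ *-distribˡ-+ (2 + k) c _ ⟩
  (c + suc k * c) + (2 + k) * (suc m C (2 + k))
    ≡⟨ cong₂ (λ a b → (c + a) + b) ([k+1]*[m+1]C[k+1]≡[m+1]*mCk m k)
                                   ([k+1]*[m+1]C[k+1]≡[m+1]*mCk m (suc k)) ⟩
  (c + suc m * (m C k)) + suc m * (m C suc k)
    ≡⟨ regroup c (suc m) (m C k) (m C suc k) ⟩
  c + suc m * ((m C k) + (m C suc k))
    ≡⟨ cong (λ a → c + suc m * a) (nCk+nC[k+1]≡[n+1]C[k+1] m k) ⟩
  suc (suc m) * c ∎
  where
  open ≡-Reasoning
  c = suc m C suc k
  regroup : ∀ c m a b → (c + m * a) + m * b ≡ c + m * (a + b)
  regroup = solve-∀

[n+1]*catalan≡2nCn : ∀ n → suc n * catalan n ≡ (2 * n) C n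
[n+1]*catalan≡2nCn n = trans (*-comm (suc n) (catalan n)) (m/n*n≡m n+1∣c)
  where
  c = (2 * n) C n
  n+1∣[2n+1]c : suc n ∣ suc (2 * n) * c
  n+1∣[2n+1]c = subst (suc n ∣_) ([k+1]*[m+1]C[k+1]≡[m+1]*mCk (2 * n) n) (m∣m*n _)
  double : ∀ n c → suc (2 * n) * c + c ≡ 2 * c * suc n
  double = solve-∀
  n+1∣c : suc n ∣ c
  n+1∣c = ∣m+n∣m⇒∣n (divides (2 * c) (double n c)) n+1∣[2n+1]c

{-# OPTIONS --termination-depth=2 #-}
-- A permutation σ ∈ S_{n,k} is determined by the multisets of entries of
-- Θ(σ), …, Θᵏ(σ).  Comparing last entries and deleting them shows two things:
-- two sequences with the same multiset and the same image under Θ are equal, and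
-- two fixed points of Θ with the same multiset are equal.  Starting from Θᵏ(σ) and
-- going down, σ is recovered, all permutations having the same multiset.
-- Each Θⁱ(σ) with i ≥ 1 has at least v entries below v for every v ≤ n, so its weakly
-- increasing rearrangement b₁ ≤ … ≤ bₙ satisfies bᵢ < i, which leaves C_n
-- possibilities by the ballot recursion.
module Submission where

open import Defs
open import Data.Nat using (ℕ; _≤_; _^_)

open import Data.Fin.Base using (Fin; zero; suc)
import Data.Fin.Base as Fin
import Data.Fin.Properties as Fin
open import Data.List.Base using (List; []; _∷_; _++_; [_]; length; filter; map; reverse; _ʳ++_; cartesianProductWith; allFin)
import Data.List.Base as List
open import Data.List.Properties using (length-++; length-map; length-reverse; filter-accept; filter-reject; filter-none; length-filter; reverse-injective; ∷-injectiveˡ; ∷-injectiveʳ)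
open import Data.List.Membership.Propositional using (_∈_)
open import Data.List.Membership.Propositional.Properties using (∈-∃++; ∈-++⁻; ∈-++⁺ˡ; ∈-++⁺ʳ; ∈-map⁺)
open import Data.List.Relation.Binary.Permutation.Propositional using (_↭_; ↭-sym; ↭-trans; ↭-reflexive)
open import Data.List.Relation.Binary.Permutation.Propositional.Properties using (∈-resp-↭; drop-∷; ¬x∷xs↭[]; filter-↭; ↭-length; ↭-reverse)
open import Data.List.Relation.Unary.All using (All; []; _∷_)
import Data.List.Relation.Unary.All as All
open import Data.List.Relation.Unary.AllPairs using (AllPairs; []; _∷_)
open import Data.List.Relation.Unary.Any using (here; there)
open import Data.List.Relation.Unary.Sorted.TotalOrder.Properties using (Sorted⇒AllPairs)
open import Data.List.Relation.Unary.Unique.Propositional using (Unique)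
open import Data.Nat.Base using (zero; suc; _+_; _*_; _<_; z≤n; s≤s; z<s; s<s; s<s⁻¹; s≤s⁻¹)
open import Data.Nat.Combinatorics using (_C_; nCk+nC[k+1]≡[n+1]C[k+1]; nCk≡nC[n∸k]; nCn≡1; k>n⇒nCk≡0)
open import Data.Nat.GeneralisedArithmetic using (fold)
open import Data.Nat.Properties
open import Data.Nat.Tactic.RingSolver using (solve-∀)
open import Data.List.Sort ≤-decTotalOrder using (sort; sort-↭; sort-↗)
open import Data.Product.Base using (_×_; _,_; proj₂)
open import Data.Sum.Base using (inj₁; inj₂)
open import Data.Vec.Base using (Vec; []; _∷_; lookup; tabulate; toList)
open import Data.Vec.Properties using (toList-injective; length-toList; tabulate-cong; cast-is-id)
import Data.Vec.Properties as Vec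
open import Function.Base using (id; _∘_)
open import Function.Bundles using (_⇔_; mk⇔; Equivalence)
open import Level using (0ℓ)
open import Relation.Binary.Definitions using (tri<; tri≈; tri>)
open import Relation.Binary.PropositionalEquality using (_≡_; refl; sym; trans; cong; cong₂; subst; subst₂; module ≡-Reasoning)
open import Relation.Nullary using (¬_; yes; no; contradiction)
open import Relation.Nullary.Decidable using (_×-dec_)
open import Relation.Unary using (Pred; Decidable)

-- Injections between finite lists and counting lemmas.

module _ {A B : Set} (f : A → B) where

  -- One occurrence of `f x` is deleted from `ys`. By distinctness and injectivity the images of the
  -- remaining entries differ from `f x`, so they survive the deletion.
  length-≤-injective : ∀ {xs ys} → Unique xs →
    (∀ {x y} → x ∈ xs → y ∈ xs → f x ≡ f y → x ≡ y) →
    (∀ {x} → x ∈ xs → f x ∈ ys) → length xs ≤ length ys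
  length-≤-injective {[]}     _          _   _   = z≤n
  length-≤-injective {x ∷ xs} (x∉xs ∷ u) inj mem with ∈-∃++ (mem (here refl))
  ... | as , bs , refl = begin
    suc (length xs)             ≤⟨ s≤s (length-≤-injective u (λ p q → inj (there p) (there q)) mem′) ⟩
    suc (length (as ++ bs))     ≡⟨ cong suc (length-++ as) ⟩
    suc (length as + length bs) ≡⟨ +-suc (length as) (length bs) ⟨
    length as + suc (length bs) ≡⟨ length-++ as ⟨
    length (as ++ f x ∷ bs)     ∎
    where
    open ≤-Reasoning
    mem′ : ∀ {y} → y ∈ xs → f y ∈ as ++ bs
    mem′ y∈xs with ∈-++⁻ as (mem (there y∈xs))
    ... | inj₁ p            = ∈-++⁺ˡ p
    ... | inj₂ (there p)    = ∈-++⁺ʳ as p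
    ... | inj₂ (here fy≡fx) =
      contradiction (inj (here refl) (there y∈xs) (sym fy≡fx)) (All.lookup x∉xs y∈xs)

length-cartesianProductWith : ∀ {A B D : Set} (f : A → B → D) xs ys →
  length (cartesianProductWith f xs ys) ≡ length xs * length ys
length-cartesianProductWith f []       ys = refl
length-cartesianProductWith f (x ∷ xs) ys = trans (length-++ (map (f x) ys))
  (cong₂ _+_ (length-map (f x) ys) (length-cartesianProductWith f xs ys))

length-vecs : ∀ {A : Set} (xs : List A) k → length (vecs xs k) ≡ length xs ^ k
length-vecs xs zero    = refl
length-vecs xs (suc k) = trans (length-cartesianProductWith _∷_ xs (vecs xs k))
  (cong (length xs *_) (length-vecs xs k))

length-filter-tabulate : ∀ {A B : Set} {P : Pred A 0ℓ} {Q : Pred B 0ℓ}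
  (P? : Decidable P) (Q? : Decidable Q) {n} (f : Fin n → A) (g : Fin n → B) →
  (∀ i → P (f i) ⇔ Q (g i)) →
  length (filter P? (List.tabulate f)) ≡ length (filter Q? (List.tabulate g))
length-filter-tabulate P? Q? {zero}  f g P⇔Q = refl
length-filter-tabulate P? Q? {suc n} f g P⇔Q
  with P? (f zero) | Q? (g zero) | length-filter-tabulate P? Q? (f ∘ suc) (g ∘ suc) (P⇔Q ∘ suc)
... | yes _ | yes _ | eq = cong suc eq
... | no  _ | no  _ | eq = eq
... | yes p | no ¬q | _  = contradiction (Equivalence.to (P⇔Q zero) p) ¬q
... | no ¬p | yes q | _  = contradiction (Equivalence.from (P⇔Q zero) q) ¬p

-- Number of entries below a value.

below : ℕ → List ℕ → ℕ
below v xs = length (filter (_<? v) xs)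

below-accept : ∀ {v x} xs → x < v → below v (x ∷ xs) ≡ suc (below v xs)
below-accept {v} xs x<v = cong length (filter-accept (_<? v) x<v)

below-reject : ∀ {v x} xs → ¬ x < v → below v (x ∷ xs) ≡ below v xs
below-reject {v} xs x≮v = cong length (filter-reject (_<? v) x≮v)

below-∷-≤ : ∀ v x xs → below v xs ≤ below v (x ∷ xs)
below-∷-≤ v x xs with x <? v
... | yes x<v = ≤-trans (n≤1+n _) (≤-reflexive (sym (below-accept xs x<v)))
... | no  x≮v = ≤-reflexive (sym (below-reject xs x≮v))

below-monoˡ-≤ : ∀ {v w} xs → v ≤ w → below v xs ≤ below w xs
below-monoˡ-≤ []       v≤w = z≤n
below-monoˡ-≤ {v} {w} (x ∷ xs) v≤w with x <? v
... | no x≮v = ≤-trans (≤-reflexive (below-reject xs x≮v))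
                 (≤-trans (below-monoˡ-≤ xs v≤w) (below-∷-≤ w x xs))
... | yes x<v = begin
  below v (x ∷ xs)  ≡⟨ below-accept xs x<v ⟩
  suc (below v xs)  ≤⟨ s≤s (below-monoˡ-≤ xs v≤w) ⟩
  suc (below w xs)  ≡⟨ below-accept xs (≤-trans x<v v≤w) ⟨
  below w (x ∷ xs)  ∎
  where open ≤-Reasoning

below-↭ : ∀ v {xs ys} → xs ↭ ys → below v xs ≡ below v ys
below-↭ v p = ↭-length (filter-↭ (_<? v) p)

below-none : ∀ {v xs} → All (v ≤_) xs → below v xs ≡ 0
below-none {v} v≤xs = cong length (filter-none (_<? v) (All.map ≤⇒≯ v≤xs))

-- The map Θ on reversed lists: injectivity on rearrangements and fixed points.

-- Sequences are handled as lists with the last entry first, so that deleting the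
-- last entry is taking the tail.
θ : List ℕ → List ℕ
θ []       = []
θ (x ∷ xs) = below x xs ∷ θ xs

θ-length : ∀ xs → length (θ xs) ≡ length xs
θ-length []       = refl
θ-length (x ∷ xs) = cong suc (θ-length xs)

-- In the common multiset, the entries below `y` include `x` besides the entries of `xs` below `x`.
-- Removing `y` itself loses none of them.
rank-mono-< : ∀ {x y xs ys} → x ∷ xs ↭ y ∷ ys → x < y → below x xs < below y ys
rank-mono-< {x} {y} {xs} {ys} p x<y = begin-strict
  below x xs        ≤⟨ below-monoˡ-≤ xs (<⇒≤ x<y) ⟩
  below y xs        <⟨ ≤-reflexive (sym (below-accept xs x<y)) ⟩
  below y (x ∷ xs)  ≡⟨ below-↭ y p ⟩
  below y (y ∷ ys)  ≡⟨ below-reject ys (<-irrefl refl) ⟩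
  below y ys        ∎
  where open ≤-Reasoning

θ-injective : ∀ {xs ys} → xs ↭ ys → θ xs ≡ θ ys → xs ≡ ys
θ-injective {[]}     {[]}     _ _ = refl
θ-injective {[]}     {y ∷ ys} p _ = contradiction (↭-sym p) ¬x∷xs↭[]
θ-injective {x ∷ xs} {[]}     p _ = contradiction p ¬x∷xs↭[]
θ-injective {x ∷ xs} {y ∷ ys} p eq with <-cmp x y
... | tri≈ _ refl _ = cong (x ∷_) (θ-injective (drop-∷ p) (∷-injectiveʳ eq))
... | tri< x<y _ _  = contradiction (∷-injectiveˡ eq) (<⇒≢ (rank-mono-< p x<y))
... | tri> _ _ y<x  = contradiction (sym (∷-injectiveˡ eq)) (<⇒≢ (rank-mono-< (↭-sym p) y<x))

-- An occurrence of `v` in a fixed point has exactly `v` smaller entries before it, and later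
-- entries can only add to them.
fixed-below : ∀ {xs v} → θ xs ≡ xs → v ∈ xs → v ≤ below v xs
fixed-below {x ∷ xs} eq (here refl) =
  ≤-trans (≤-reflexive (sym (∷-injectiveˡ eq))) (below-∷-≤ x x xs)
fixed-below {x ∷ xs} {v} eq (there v∈xs) =
  ≤-trans (fixed-below (∷-injectiveʳ eq) v∈xs) (below-∷-≤ v x xs)

-- A second value y > x occurring in x ∷ xs occurs in xs, with already y smaller
-- entries before it; the last entry x makes this y + 1.
fixed-head-≮ : ∀ {x y xs ys} → x ∷ xs ↭ y ∷ ys →
  θ (x ∷ xs) ≡ x ∷ xs → θ (y ∷ ys) ≡ y ∷ ys → ¬ x < y
fixed-head-≮ {x} {y} {xs} {ys} p fx fy x<y = <-irrefl refl (begin-strict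
  y                 ≤⟨ fixed-below (∷-injectiveʳ fx) (y∈xs (∈-resp-↭ (↭-sym p) (here refl))) ⟩
  below y xs        <⟨ ≤-reflexive (sym (below-accept xs x<y)) ⟩
  below y (x ∷ xs)  ≡⟨ below-↭ y p ⟩
  below y (y ∷ ys)  ≡⟨ below-reject ys (<-irrefl refl) ⟩
  below y ys        ≡⟨ ∷-injectiveˡ fy ⟩
  y                 ∎)
  where
  open ≤-Reasoning
  y∈xs : y ∈ x ∷ xs → y ∈ xs
  y∈xs (here refl) = contradiction x<y (<-irrefl refl)
  y∈xs (there q)   = q

fixed-injective : ∀ {xs ys} → xs ↭ ys → θ xs ≡ xs → θ ys ≡ ys → xs ≡ ys
fixed-injective {[]}     {[]}     _ _  _  = refl
fixed-injective {[]}     {y ∷ ys} p _  _  = contradiction (↭-sym p) ¬x∷xs↭[]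
fixed-injective {x ∷ xs} {[]}     p _  _  = contradiction p ¬x∷xs↭[]
fixed-injective {x ∷ xs} {y ∷ ys} p fx fy with <-cmp x y
... | tri< x<y _ _  = contradiction x<y (fixed-head-≮ p fx fy)
... | tri> _ _ y<x  = contradiction y<x (fixed-head-≮ (↭-sym p) fy fx)
... | tri≈ _ refl _ =
  cong (x ∷_) (fixed-injective (drop-∷ p) (∷-injectiveʳ fx) (∷-injectiveʳ fy))

-- Recovering a sequence from the multisets of its iterates.

fold-shift : ∀ {A : Set} (s : A → A) z k → fold (s z) s k ≡ s (fold z s k)
fold-shift s z zero    = refl
fold-shift s z (suc k) = cong s (fold-shift s z k)

-- Sorting gives each multiset a single representative, so that profiles can be counted.
profile : ∀ k → List ℕ → Vec (List ℕ) k
profile zero    xs = []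
profile (suc k) xs = sort (θ xs) ∷ profile k (θ xs)

sort-injective-↭ : ∀ xs ys → sort xs ≡ sort ys → xs ↭ ys
sort-injective-↭ xs ys eq =
  ↭-trans (↭-sym (sort-↭ xs)) (↭-trans (↭-reflexive eq) (sort-↭ ys))

EventuallyFixed : ℕ → List ℕ → Set
EventuallyFixed k xs = θ (fold xs θ k) ≡ fold xs θ k

-- The first entry of the profile makes `θ xs` and `θ ys` rearrangements of each other, induction
-- makes them equal, and `θ-injective` goes back one step.
profile-injective : ∀ k {xs ys} → xs ↭ ys → EventuallyFixed k xs → EventuallyFixed k ys →
  profile k xs ≡ profile k ys → xs ≡ ys
profile-injective zero    p fx fy _  = fixed-injective p fx fy
profile-injective (suc k) {xs} {ys} p fx fy eq = θ-injective p
  (profile-injective k (sort-injective-↭ (θ xs) (θ ys) (Vec.∷-injectiveˡ eq))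
    (shift xs fx) (shift ys fy) (Vec.∷-injectiveʳ eq))
  where
  shift : ∀ zs → EventuallyFixed (suc k) zs → EventuallyFixed k (θ zs)
  shift zs = subst (λ us → θ us ≡ us) (sym (fold-shift θ zs k))

-- Small values in the image of Θ.

θ-below : ∀ xs {v} → v ≤ length xs → v ≤ below v (θ xs)
θ-below []       z≤n = z≤n
θ-below (x ∷ xs) {zero}  _   = z≤n
θ-below (x ∷ xs) {suc v} v≤n with below x xs <? suc v
... | yes r<v = begin
  suc v                              ≤⟨ s≤s (θ-below xs (s≤s⁻¹ v≤n)) ⟩
  suc (below v (θ xs))               ≤⟨ s≤s (below-monoˡ-≤ (θ xs) (n≤1+n v)) ⟩
  suc (below (suc v) (θ xs))         ≡⟨ below-accept (θ xs) r<v ⟨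
  below (suc v) (θ (x ∷ xs))         ∎
  where open ≤-Reasoning
... | no r≮v = begin
  -- The last rank is at least `suc v` and adds nothing here; but it is at most the length of `xs`,
  -- so the induction hypothesis applies to `suc v` itself.
  suc v                       ≤⟨ θ-below xs (≤-trans (≮⇒≥ r≮v) (length-filter (_<? x) xs)) ⟩
  below (suc v) (θ xs)        ≤⟨ below-∷-≤ (suc v) (below x xs) (θ xs) ⟩
  below (suc v) (θ (x ∷ xs))  ∎
  where open ≤-Reasoning

-- Ballot lists and the Catalan numbers.

-- The weakly increasing lists of e further entries b_i ≥ v with b_i ≤ i, positions
-- counted from 0 and the next position being v + s.
ballots : (e s v : ℕ) → List (List ℕ)
ballots zero    s       v = [ [] ]
ballots (suc e) zero    v = map (v ∷_) (ballots e 1 v)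
ballots (suc e) (suc s) v = map (v ∷_) (ballots e (2 + s) v) ++ ballots (suc e) s (suc v)

-- For n = 2e + s and k = e + s this is l = C(n, e) - C(n, e - 1), with both binomial
-- coefficients reflected and the subtraction removed.
Ballot : ℕ → ℕ → ℕ → Set
Ballot l n k = l + n C suc k ≡ n C k

-- Pascal's rule, applied to both binomial coefficients, mirrors the two branches of `ballots`.
ballot-step : ∀ l₁ l₂ n k → Ballot l₁ n (suc k) → Ballot l₂ n k →
  Ballot (l₁ + l₂) (suc n) (suc k)
ballot-step l₁ l₂ n k b₁ b₂ = begin
  (l₁ + l₂) + suc n C suc (suc k)              ≡⟨ cong ((l₁ + l₂) +_) (nCk+nC[k+1]≡[n+1]C[k+1] n (suc k)) ⟨
  (l₁ + l₂) + (n C suc k + n C suc (suc k))    ≡⟨ regroup l₁ l₂ (n C suc k) _ ⟩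
  (l₂ + n C suc k) + (l₁ + n C suc (suc k))    ≡⟨ cong₂ _+_ b₂ b₁ ⟩
  n C k + n C suc k                            ≡⟨ nCk+nC[k+1]≡[n+1]C[k+1] n k ⟩
  suc n C suc k                                ∎
  where
  open ≡-Reasoning
  regroup : ∀ a b c d → (a + b) + (c + d) ≡ (b + c) + (a + d)
  regroup = solve-∀

-- For `s` = 0 the second branch is absent. It counts as 0 because the two middle coefficients of
-- the odd row 2e + 1 agree.
ballot-step₀ : ∀ l e → Ballot l (suc (e + e)) (suc e) → Ballot l (suc (suc (e + e))) (suc e)
ballot-step₀ l e b = subst (λ l′ → Ballot l′ (suc n) (suc e)) (+-identityʳ l)
  (ballot-step l 0 n e b symmetric)
  where
  n = suc (e + e)
  symmetric : n C suc e ≡ n C e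
  symmetric = sym (trans (nCk≡nC[n∸k] (m≤n+m e (suc e))) (cong (n C_) (m+n∸n≡m (suc e) e)))

-- Both branches lie in the same row, one less than the row of the whole, and their lower indices
-- differ by one, as `ballot-step` requires.
ballots-length : ∀ e s v → Ballot (length (ballots e s v)) (e + (e + s)) (e + s)
ballots-length zero s v = trans (cong suc (k>n⇒nCk≡0 (n<1+n s))) (sym (nCn≡1 s))
ballots-length (suc e) zero v =
  subst₂ (Ballot _) (size e) (cong suc (sym (+-identityʳ e)))
    (ballot-step₀ _ e (subst (λ l → Ballot l (suc (e + e)) (suc e))
      (sym (length-map (v ∷_) (ballots e 1 v)))
      (subst₂ (Ballot _) (size₁ e) (+-comm e 1) (ballots-length e 1 v))))
  where
  size : ∀ e → suc (suc (e + e)) ≡ suc e + (suc e + 0)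
  size = solve-∀
  size₁ : ∀ e → e + (e + 1) ≡ suc (e + e)
  size₁ = solve-∀
ballots-length (suc e) (suc s) v =
  subst (λ l → Ballot l (suc e + (suc e + suc s)) (suc e + suc s))
    (sym (trans (length-++ (map (v ∷_) (ballots e (2 + s) v)))
                (cong (_+ length (ballots (suc e) s (suc v))) (length-map (v ∷_) (ballots e (2 + s) v)))))
    (subst₂ (Ballot _) (size e s) (cong suc (sym (+-suc e s)))
      (ballot-step (length (ballots e (2 + s) v)) _ (suc e + (suc e + s)) (suc e + s)
        (subst₂ (Ballot _) (size₁ e s) (index e s) (ballots-length e (2 + s) v))
        (ballots-length (suc e) s (suc v))))
  where
  size : ∀ e s → suc (suc e + (suc e + s)) ≡ suc e + (suc e + suc s)
  size = solve-∀
  size₁ : ∀ e s → e + (e + (2 + s)) ≡ suc e + (suc e + s)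
  size₁ = solve-∀
  index : ∀ e s → e + (2 + s) ≡ suc (suc e + s)
  index = solve-∀

-- The count is C(2n, n) - C(2n, n + 1). Adding (2n + 1) C(2n, n) to n + 1 times it avoids
-- subtraction and lets the absorption identity eliminate the second coefficient.
ballots-catalan : ∀ n → length (ballots n 0 0) ≡ catalan n
ballots-catalan n = *-cancelˡ-≡ l (catalan n) (suc n)
  (+-cancelˡ-≡ (suc (2 * n) * c) (suc n * l) (suc n * catalan n) (begin
    suc (2 * n) * c + suc n * l                      ≡⟨ cong (_+ suc n * l) ([k+1]*[m+1]C[k+1]≡[m+1]*mCk (2 * n) n) ⟨
    suc n * (suc (2 * n) C suc n) + suc n * l        ≡⟨ cong (λ z → suc n * z + suc n * l) (nCk+nC[k+1]≡[n+1]C[k+1] (2 * n) n) ⟨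
    suc n * (c + c′) + suc n * l                     ≡⟨ regroup n c c′ l ⟩
    suc n * c + suc n * (l + c′)                     ≡⟨ cong (λ z → suc n * c + suc n * z) ballot ⟩
    suc n * c + suc n * c                            ≡⟨ double n c ⟩
    suc (2 * n) * c + c                              ≡⟨ cong (suc (2 * n) * c +_) ([n+1]*catalan≡2nCn n) ⟨
    suc (2 * n) * c + suc n * catalan n              ∎))
  where
  open ≡-Reasoning
  l = length (ballots n 0 0)
  c = (2 * n) C n
  c′ = (2 * n) C suc n
  ballot : l + c′ ≡ c
  ballot = subst (λ k → l + (n + (n + 0)) C suc k ≡ (n + (n + 0)) C k) (+-identityʳ n)
             (ballots-length n 0 0)
  regroup : ∀ n c d l → suc n * (c + d) + suc n * l ≡ suc n * c + suc n * (l + d)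
  regroup = solve-∀
  double : ∀ n c → suc n * c + suc n * c ≡ suc (2 * n) * c + c
  double = solve-∀

-- Sorted lists with enough small entries are ballot lists.

-- The v + s entries placed before xs are all at most v; for every u = v + j > v up
-- to the final length, at least u entries of the completed list are below u.
Ample : ℕ → ℕ → List ℕ → Set
Ample s v xs = ∀ j → j ≤ s + length xs → j ≤ s + below (v + j) xs

-- The placed entry `v` is below every `v + suc j`, so it moves from the count into the slack.
ample-place : ∀ s v {xs} → Ample s v (v ∷ xs) → Ample (suc s) v xs
ample-place s v {xs} h zero    _   = z≤n
ample-place s v {xs} h (suc j) j≤n = begin
  suc j                           ≤⟨ h (suc j) (≤-trans j≤n (≤-reflexive (sym (+-suc s (length xs))))) ⟩
  s + below (v + suc j) (v ∷ xs)  ≡⟨ cong (s +_) (below-accept xs (m<m+n v z<s)) ⟩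
  s + suc (below (v + suc j) xs)  ≡⟨ +-suc s _ ⟩
  suc s + below (v + suc j) xs    ∎
  where open ≤-Reasoning

ample-raise : ∀ s v xs → Ample (suc s) v xs → Ample s (suc v) xs
ample-raise s v xs h j j≤n = s≤s⁻¹
  (subst (λ w → suc j ≤ suc s + below w xs) (+-suc v j) (h (suc j) (s≤s j≤n)))

-- Without slack, the case `j` = 1 demands an entry below `v + 1`.
¬ample-zero : ∀ {v x xs} → All (v <_) (x ∷ xs) → ¬ Ample 0 v (x ∷ xs)
¬ample-zero {v} v<xs h = n≮0 (≤-trans (h 1 (s≤s z≤n))
  (≤-reflexive (below-none (All.map (≤-trans (≤-reflexive (+-comm v 1))) v<xs))))

-- The head is minimal. If it is `v`, it is placed; otherwise all entries exceed `v`, and `v` is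
-- raised at the cost of one unit of slack, which must then be available.
∈-ballots : ∀ e s v {xs} → AllPairs _≤_ xs → All (v ≤_) xs → length xs ≡ e →
  Ample s v xs → xs ∈ ballots e s v
∈-ballots zero    s v {[]} _ _ _ _ = here refl
∈-ballots (suc e) zero v {x ∷ xs} (x≤xs ∷ sorted) (v≤x ∷ v≤xs) len h with m≤n⇒m<n∨m≡n v≤x
... | inj₂ refl = ∈-map⁺ (v ∷_) (∈-ballots e 1 v sorted v≤xs (suc-injective len) (ample-place 0 v h))
... | inj₁ v<x  = contradiction h (¬ample-zero (v<x ∷ All.map (≤-trans v<x) x≤xs))
∈-ballots (suc e) (suc s) v {x ∷ xs} (x≤xs ∷ sorted) (v≤x ∷ v≤xs) len h with m≤n⇒m<n∨m≡n v≤x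
... | inj₂ refl = ∈-++⁺ˡ (∈-map⁺ (v ∷_)
  (∈-ballots e (2 + s) v sorted v≤xs (suc-injective len) (ample-place (suc s) v h)))
... | inj₁ v<x  = ∈-++⁺ʳ (map (v ∷_) (ballots e (2 + s) v))
  (∈-ballots (suc e) s (suc v) (x≤xs ∷ sorted) (v<x ∷ All.map (≤-trans v<x) x≤xs) len
    (ample-raise s v (x ∷ xs) h))

sort-θ-∈-ballots : ∀ {n} xs → length xs ≡ n → sort (θ xs) ∈ ballots n 0 0
sort-θ-∈-ballots xs refl = ∈-ballots (length xs) 0 0
  (Sorted⇒AllPairs ≤-totalOrder (sort-↗ (θ xs))) (All.universal (λ _ → z≤n) _)
  (trans (↭-length (sort-↭ (θ xs))) (θ-length xs))
  -- For `s` = `v` = 0, `Ample` is the bound of `θ-below`, which depends only on the multiset.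
  (λ j j≤n → subst (j ≤_) (sym (below-↭ j (sort-↭ (θ xs))))
    (θ-below xs (≤-trans j≤n (≤-reflexive (trans (↭-length (sort-↭ (θ xs))) (θ-length xs))))))

profile-∈-ballots : ∀ {n} k xs → length xs ≡ n →
  ∀ {b} → b ∈ toList (profile k xs) → b ∈ ballots n 0 0
profile-∈-ballots (suc k) xs eq (here refl) = sort-θ-∈-ballots xs eq
profile-∈-ballots (suc k) xs eq (there b∈)  =
  profile-∈-ballots k (θ xs) (trans (θ-length xs) eq) b∈

-- Agreement of Θ on vectors with `θ` on reversed lists.

module _ {n} (σ : Vec ℕ n) (i : Fin n) where

  Smaller? : Decidable (λ j → j Fin.< i × lookup σ j < lookup σ i)
  Smaller? j = (j Fin.<? i) ×-dec (lookup σ j <? lookup σ i)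

  -- This repeats the body of `Θ`, so that `Θ σ` and `tabulate (rank σ)` agree by computation.
  rank : ℕ
  rank = length (filter Smaller? (allFin n))

rank-zero : ∀ {n} x (σ : Vec ℕ n) → rank (x ∷ σ) zero ≡ 0
rank-zero x σ = cong length (filter-none (Smaller? (x ∷ σ) zero)
  (All.universal (λ _ ()) (allFin _)))

later-rank : ∀ {n} x (σ : Vec ℕ n) i →
  length (filter (Smaller? (x ∷ σ) (suc i)) (List.tabulate suc)) ≡ rank σ i
later-rank x σ i = length-filter-tabulate (Smaller? (x ∷ σ) (suc i)) (Smaller? σ i) suc id
  λ j → mk⇔ (λ (p , q) → s<s⁻¹ p , q) (λ (p , q) → s<s p , q)

-- Moving `x` from the vector to `acc` transfers its contribution from the rank to `below`.
rank-suc : ∀ {n} x (σ : Vec ℕ n) i acc →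
  below (lookup σ i) acc + rank (x ∷ σ) (suc i) ≡ below (lookup σ i) (x ∷ acc) + rank σ i
rank-suc {n} x σ i acc with x <? lookup σ i
... | yes x<σi = begin
  b + rank (x ∷ σ) (suc i)      ≡⟨ cong (λ js → b + length js)
                                     (filter-accept (Smaller? (x ∷ σ) (suc i)) (z<s , x<σi)) ⟩
  b + suc (length later)        ≡⟨ +-suc b _ ⟩
  suc b + length later          ≡⟨ cong₂ _+_ (sym (below-accept acc x<σi)) (later-rank x σ i) ⟩
  below (lookup σ i) (x ∷ acc) + rank σ i ∎
  where
  open ≡-Reasoning
  b = below (lookup σ i) acc
  later = filter (Smaller? (x ∷ σ) (suc i)) (List.tabulate suc)
... | no x≮σi = cong₂ _+_ (sym (below-reject acc x≮σi))
  (trans (cong length (filter-reject (Smaller? (x ∷ σ) (suc i)) {x = zero} {xs = List.tabulate suc} (x≮σi ∘ proj₂)))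
    (later-rank x σ i))

-- Generalised for the induction: `acc` holds the entries that precede `σ`, the latest first, and
-- these contribute the summand `below`.
reverse-θ : ∀ {n} (σ : Vec ℕ n) acc →
  θ (toList σ ʳ++ acc) ≡ toList (tabulate (λ i → below (lookup σ i) acc + rank σ i)) ʳ++ θ acc
reverse-θ []      acc = refl
reverse-θ (x ∷ σ) acc = begin
  θ (toList σ ʳ++ (x ∷ acc))
    ≡⟨ reverse-θ σ (x ∷ acc) ⟩
  toList (tabulate λ i → below (lookup σ i) (x ∷ acc) + rank σ i) ʳ++ (below x acc ∷ θ acc)
    ≡⟨ cong₂ (λ τ y → toList τ ʳ++ (y ∷ θ acc))
         (tabulate-cong λ i → rank-suc x σ i acc)
         (trans (cong (below x acc +_) (rank-zero x σ)) (+-identityʳ _)) ⟨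
  toList (tabulate λ i → below (lookup (x ∷ σ) i) acc + rank (x ∷ σ) i) ʳ++ θ acc ∎
  where open ≡-Reasoning

past : ∀ {n} → Vec ℕ n → List ℕ
past σ = reverse (toList σ)

past-injective : ∀ {n} {σ ρ : Vec ℕ n} → past σ ≡ past ρ → σ ≡ ρ
past-injective {σ = σ} {ρ} eq =
  trans (sym (cast-is-id refl σ)) (toList-injective refl σ ρ (reverse-injective eq))

past-Θ : ∀ {n} (σ : Vec ℕ n) → past (Θ σ) ≡ θ (past σ)
-- For the empty accumulator the summand `below` computes to 0.
past-Θ σ = sym (reverse-θ σ [])

past-Θ^ : ∀ {n} k (σ : Vec ℕ n) → past (Θ^ k σ) ≡ fold (past σ) θ k
past-Θ^ zero    σ = refl
past-Θ^ (suc k) σ = trans (past-Θ (Θ^ k σ)) (cong θ (past-Θ^ k σ))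

S⇒EventuallyFixed : ∀ {n} k {σ : Vec ℕ n} → S n k σ → EventuallyFixed k (past σ)
S⇒EventuallyFixed k {σ} (_ , _ , fixed) = subst (λ xs → θ xs ≡ xs) (past-Θ^ k σ)
  (trans (sym (past-Θ (Θ^ k σ))) (cong past fixed))

past-↭ : ∀ {n k} {σ ρ : Vec ℕ n} → S n k σ → S n k ρ → past σ ↭ past ρ
past-↭ {σ = σ} {ρ} (pσ , _) (pρ , _) = ↭-trans (↭-reverse (toList σ))
  (↭-trans (↭-trans pσ (↭-sym pρ)) (↭-sym (↭-reverse (toList ρ))))

-- Counting permutations by their profiles.

theorem6p4 : ∀ (n k : ℕ) → card (S-finite n k) ≤ catalan n ^ k
theorem6p4 n k = begin
  length members                   ≤⟨ length-≤-injective (profile k ∘ past) distinct injective mem ⟩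
  length (vecs (ballots n 0 0) k)  ≡⟨ length-vecs (ballots n 0 0) k ⟩
  length (ballots n 0 0) ^ k       ≡⟨ cong (_^ k) (ballots-catalan n) ⟩
  catalan n ^ k                    ∎
  where
  open ≤-Reasoning
  open Finite (S-finite n k)
  inS : ∀ {σ} → σ ∈ members → S n k σ
  inS {σ} = Equivalence.to (complete σ)
  injective : ∀ {σ ρ} → σ ∈ members → ρ ∈ members →
    profile k (past σ) ≡ profile k (past ρ) → σ ≡ ρ
  injective σ∈ ρ∈ eq = past-injective (profile-injective k (past-↭ {k = k} (inS σ∈) (inS ρ∈))
    (S⇒EventuallyFixed k (inS σ∈)) (S⇒EventuallyFixed k (inS ρ∈)) eq)
  mem : ∀ {σ} → σ ∈ members → profile k (past σ) ∈ vecs (ballots n 0 0) k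
  mem {σ} _ = ∈-vecs (profile k (past σ)) (profile-∈-ballots k (past σ)
    (trans (length-reverse (toList σ)) (length-toList σ)))
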